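{- A multi-head HyTN $\mathcal{H}$ is consistent if and only if it is conservative. Moreover, when all weights of $\mathcal{H}$ are integers, $\mathcal{H}$ admits an integral feasible scheduling if and only if it is conservative.
   Context: A multi-head HyTN is $\mathcal{H}=(V,\mathcal{A})$ where each hyperarc is $A=(t_A,H_A,w_A)$ with tail $t_A\in V$, nonempty head set $H_A\subseteq V\setminus\{t_A\}$ and weights $w_A(v)\in\mathbb{R}$, $v\in H_A$. A scheduling $s:V\to\mathbb{R}$ is feasible if $s(t_A)\ge\min_{v\in H_A}\{s(v)-w_A(v)\}$ for every $A$; $\mathcal{H}$ is consistent if it has a feasible scheduling. A cycle of $\mathcal{H}$ is a pair $(S,\mathcal{C})$ with $S\subseteq V$, $\mathcal{C}\subseteq\mathcal{A}$ such that $S=\bigcup_{A\in\mathcal{C}}(H_A\cup\{t_A\})\neq\emptyset$ and for every $v\in S$ there is a unique $A\in\mathcal{C}$ with $t_A=v$, denoted $a(v)$. A finite cyclic sequence is a sequence $v_1,\dots,v_p$ in $S$ with $v_{t+1}\in H_{a(v_t)}$, $v_p=v_1$ the only repeated node. The cycle is negative if every finite cyclic sequence satisfies $\sum_{t=1}^{p-1}w_{a(v_t)}(v_{t+1})<0$. $\mathcal{H}$ is conservative if it contains no negative cycle. -}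

module Defs where

open import Level using (Level; 0ℓ) renaming (suc to lsuc)
open import Data.Nat using (ℕ; zero; suc)
open import Data.Fin using (Fin; zero; suc; inject₁; fromℕ)
open import Data.Bool using (Bool; true; false; T)
open import Data.Product using (Σ; ∃; ∃-syntax; _×_; _,_)
open import Data.Sum using (_⊎_)
open import Data.Empty using (⊥)
open import Data.Integer as ℤ using (ℤ)
open import Relation.Nullary using (¬_)
open import Relation.Binary.PropositionalEquality using (_≡_; _≢_)
open import Relation.Binary.Structures using (IsTotalOrder)
open import Algebra.Structures using (IsCommutativeRing)

record WeightStr : Set₁ where
  field
    W    : Set
    _⊕_  : W → W → W
    _⊖_  : W → W → W
    𝟘    : W
    _≼_  : W → W → Set
    _≺_  : W → W → Set

record RealNumbers : Set₁ where
  infixl 6 _+_ _-_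
  infixl 7 _*_
  infix  4 _≤_ _<_
  field
    ℝ       : Set
    _+_ _*_ : ℝ → ℝ → ℝ
    -_      : ℝ → ℝ
    0ℝ 1ℝ   : ℝ
    _≤_     : ℝ → ℝ → Set
    isCommutativeRing : IsCommutativeRing _≡_ _+_ _*_ -_ 0ℝ 1ℝ
    0≢1     : 0ℝ ≢ 1ℝ
    inverse : ∀ x → x ≢ 0ℝ → ∃[ y ] (x * y ≡ 1ℝ)
    isTotalOrder : IsTotalOrder _≡_ _≤_
    +-mono-≤ : ∀ {x y} z → x ≤ y → x + z ≤ y + z
    *-pos    : ∀ {x y} → 0ℝ ≤ x → 0ℝ ≤ y → 0ℝ ≤ x * y
    complete : (P : ℝ → Set) → (∃[ x ] P x) → (∃[ b ] (∀ x → P x → x ≤ b)) →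
               ∃[ s ] ((∀ x → P x → x ≤ s) × (∀ b → (∀ x → P x → x ≤ b) → s ≤ b))

  _-_ : ℝ → ℝ → ℝ
  x - y = x + (- y)

  _<_ : ℝ → ℝ → Set
  x < y = (x ≤ y) × (x ≢ y)

  weightStr : WeightStr
  weightStr = record { W = ℝ ; _⊕_ = _+_ ; _⊖_ = _-_ ; 𝟘 = 0ℝ ; _≼_ = _≤_ ; _≺_ = _<_ }

ℤ-weightStr : WeightStr
ℤ-weightStr = record { W = ℤ ; _⊕_ = ℤ._+_ ; _⊖_ = ℤ._-_ ; 𝟘 = ℤ.0ℤ ; _≼_ = ℤ._≤_ ; _≺_ = ℤ._<_ }

module HyTNs (WS : WeightStr) where
  open WeightStr WS

  -- A hyperarc over node set Fin n: tail, head set (as a Boolean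
  -- predicate), weights (only the values on the head set matter),
  -- head set nonempty and not containing the tail.
  record Hyperarc (n : ℕ) : Set where
    field
      tail     : Fin n
      head     : Fin n → Bool
      weight   : Fin n → W
      nonempty : ∃[ v ] T (head v)
      tail∉head : ¬ T (head tail)

  record HyTN (n m : ℕ) : Set where
    field
      arc : Fin m → Hyperarc n

  module _ {n m : ℕ} (𝓗 : HyTN n m) where
    open HyTN 𝓗
    open Hyperarc

    -- s(t_A) ≥ min_{v ∈ H_A} (s(v) - w_A(v)); since H_A is finite and
    -- nonempty the minimum is attained, so this reads: some head v has
    -- s(v) - w_A(v) ≤ s(t_A).
    Feasible : (Fin n → W) → Set
    Feasible s = ∀ (A : Fin m) →
      ∃[ v ] (T (head (arc A) v) × ((s v ⊖ weight (arc A) v) ≼ s (tail (arc A))))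

    Consistent : Set
    Consistent = ∃[ s ] Feasible s

    record IsCycle (S : Fin n → Set) (𝓒 : Fin m → Set) : Set where
      field
        S⊆ : ∀ v → S v → ∃[ A ] (𝓒 A × (T (head (arc A) v) ⊎ tail (arc A) ≡ v))
        ⊆S : ∀ A → 𝓒 A → S (tail (arc A)) × (∀ v → T (head (arc A) v) → S v)
        S-nonempty : ∃[ v ] S v
        a-exists : ∀ v → S v → ∃[ A ] (𝓒 A × tail (arc A) ≡ v)
        a-unique : ∀ A B → 𝓒 A → 𝓒 B → tail (arc A) ≡ tail (arc B) → A ≡ B

    Σᶠ : {k : ℕ} → (Fin k → W) → W
    Σᶠ {zero}  f = 𝟘
    Σᶠ {suc k} f = f zero ⊕ Σᶠ (λ i → f (suc i))

    -- A finite cyclic sequence v₁ … v_p of a cycle (S, 𝓒), p = k + 2 ≥ 2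
    -- (indices 0 … k+1).  `arcs t` is a(v_t) (the unique arc of 𝓒 with
    -- tail v_t), for t = 0 … k.
    record CyclicSeq (S : Fin n → Set) (𝓒 : Fin m → Set) (k : ℕ) : Set where
      field
        node : Fin (suc (suc k)) → Fin n
        arcs : Fin (suc k) → Fin m
        node∈S  : ∀ t → S (node t)
        arcs∈𝓒  : ∀ t → 𝓒 (arcs t)
        arcs-tail : ∀ t → tail (arc (arcs t)) ≡ node (inject₁ t)
        step    : ∀ t → T (head (arc (arcs t)) (node (suc t)))
        closed  : node (fromℕ (suc k)) ≡ node zero
        distinct : ∀ i j → node (inject₁ i) ≡ node (inject₁ j) → i ≡ j

      length-weight : W
      length-weight = Σᶠ (λ t → weight (arc (arcs t)) (node (suc t)))

    NegativeCycle : (S : Fin n → Set) (𝓒 : Fin m → Set) → Set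
    NegativeCycle S 𝓒 = IsCycle S 𝓒 ×
      (∀ k (σ : CyclicSeq S 𝓒 k) → CyclicSeq.length-weight σ ≺ 𝟘)

    Conservative : Set₁
    Conservative = ¬ (∃[ S ] ∃[ 𝓒 ] NegativeCycle S 𝓒)

{-# OPTIONS --safe #-}
module Submission where

-- If s is feasible, following tight heads from any node of a cycle (S, 𝓒) closes up after finitely
-- many steps, and telescoping s around the closed walk shows that its weight is nonnegative.
--
-- Conversely, induct on the set of arcs.  If two arcs A ≠ B share a tail v, schedules for the networks
-- without A and without B, translated so as to agree at v, have a pointwise minimum that is feasible
-- with both arcs.  If all tails are distinct, a partial schedule is grown on a set R of nodes: it
-- extends to any tail with a head in R, to any node without arcs, and along any cyclic sequence of
-- nonnegative weight outside R.  When none of these exists, the complement of R is empty or a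
-- negative cycle.
--
-- The argument uses only a decidable totally ordered abelian group, so it covers ℝ and ℤ at once.

open import Defs
open import Algebra.Bundles using (AbelianGroup)
import Algebra.Construct.NaturalChoice.Min as Min
import Algebra.Properties.AbelianGroup as AbelianGroupProperties
import Algebra.Properties.CommutativeSemigroup as CommutativeSemigroupProperties
open import Algebra.Structures using (IsAbelianGroup; IsCommutativeRing)
open import Data.Bool using (T)
open import Data.Bool.Properties using (T?)
open import Data.Fin using (Fin; zero; suc; inject₁; fromℕ; fromℕ<; toℕ; funToFin; finToFun)
open import Data.Fin.Properties
  using (_≟_; any?; all?; pigeonhole; injective⇒≤; toℕ-inject₁; toℕ-fromℕ; toℕ-fromℕ<;
         toℕ-injective; toℕ≤pred[n]; finToFun-funToFin)
open import Data.Fin.Relation.Unary.Top using (view; ‵fromℕ; ‵inj₁)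
open import Data.Fin.Subset using (Subset; _∈_; _∉_; _⊂_; _⊃_; _-_; ⊤) renaming (⊥ to ∅)
open import Data.Fin.Subset.Induction using (⊂-wellFounded; ⊃-wellFounded)
open import Data.Fin.Subset.Properties using (_∈?_; ∈⊤; ∉⊥; x∈p⇒p-x⊂p; x∈p∧x≢y⇒x∈p-y)
import Data.Integer as ℤ
import Data.Integer.Properties as ℤ
open import Data.Nat using (ℕ; zero; suc; _+_; _<_; s≤s)
open import Data.Nat.Induction using (<-wellFounded)
open import Data.Nat.Properties
  using (+-suc; +-assoc; +-identityʳ; ≤-refl; <-≤-trans; m≤n+m; <-cmp; _<?_; m≤n⇒∃[o]m+o≡n)
open import Data.Product using (∃; ∃-syntax; _×_; _,_; proj₁; proj₂)
open import Data.Sum using (_⊎_; inj₁; inj₂; [_,_]′)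
import Data.Vec as Vec
open import Data.Vec.Properties using (lookup∘tabulate; lookup⇒[]=; []=⇒lookup)
open import Function using (_∘_)
open import Function.Bundles using (_⇔_; mk⇔)
open import Induction.WellFounded using (Acc; acc)
open import Level using (0ℓ)
open import Relation.Binary.Bundles using (TotalOrder)
open import Relation.Binary.Definitions using (tri<; tri≈; tri>)
open import Relation.Binary.PropositionalEquality
  using (_≡_; _≢_; _≗_; refl; sym; trans; cong; cong₂; subst; subst₂)
open import Relation.Binary.Structures using (IsDecTotalOrder; IsTotalOrder)
open import Relation.Nullary using (¬_; Dec; yes; no; contradiction)
open import Relation.Nullary.Decidable
  using (does; map′; decidable-stable; ¬?; _×-dec_; _⊎-dec_; _→-dec_; dec-true)
open import Relation.Unary using (Pred; Decidable)

-- Exhaustive search over finite functions and subsets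

-- A function between finite sets is coded by a single element of a finite set. Decoding the code of
-- `f` returns `f` only up to pointwise equality, hence the hypothesis that `P` respects `_≗_`.
any-fun? : ∀ {j k} {P : (Fin j → Fin k) → Set} → (∀ {f g} → f ≗ g → P f → P g) →
           Decidable P → Dec (∃ P)
any-fun? resp P? =
  map′ (λ (c , p) → finToFun c , p)
       (λ (f , p) → funToFin f , resp (sym ∘ finToFun-funToFin f) p)
       (any? (P? ∘ finToFun))

comprehension : ∀ {n} {P : Pred (Fin n) 0ℓ} → Decidable P →
                ∃[ p ] ((∀ {x} → P x → x ∈ p) × (∀ {x} → x ∈ p → P x))
comprehension {P = P} P? = p , intro , elim
  where
  p = Vec.tabulate (does ∘ P?)
  intro : ∀ {x} → P x → x ∈ p
  intro {x} px = lookup⇒[]= x p (trans (lookup∘tabulate _ x) (dec-true (P? x) px))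
  elim : ∀ {x} → x ∈ p → P x
  elim {x} x∈p with P? x | trans (sym (lookup∘tabulate (does ∘ P?) x)) ([]=⇒lookup x∈p)
  ... | yes px | _ = px
  ... | no  _  | ()

-- Simple closed stretches of a sequence in a finite set

record ClosedWalk {n : ℕ} (f : ℕ → Fin n) : Set where
  field
    start  : ℕ
    last   : ℕ
    closes : f (start + suc last) ≡ f start
    simple : ∀ (i j : Fin (suc last)) → f (start + toℕ i) ≡ f (start + toℕ j) → i ≡ j

-- The pigeonhole principle gives some closed stretch. A repetition inside it bounds a strictly
-- shorter closed stretch, so descent on the length ends at one without repetitions.
closedWalk : ∀ {n} (f : ℕ → Fin n) → ClosedWalk f
closedWalk {n} f =
  let i , j , i<j , eq = pigeonhole (≤-refl {suc n}) (f ∘ toℕ)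
      d , i+d≡j = m≤n⇒∃[o]m+o≡n i<j
  in shorten (<-wellFounded d) (toℕ i)
       (trans (cong f (trans (+-suc (toℕ i) d) i+d≡j)) (sym eq))
  where
  Repeats : ∀ {d} → ℕ → Fin (suc d) → Fin (suc d) → Set
  Repeats i a b = toℕ a < toℕ b × f (i + toℕ a) ≡ f (i + toℕ b)

  repeats? : ∀ {d} i (a b : Fin (suc d)) → Dec (Repeats i a b)
  repeats? i a b = toℕ a <? toℕ b ×-dec f (i + toℕ a) ≟ f (i + toℕ b)

  shorten : ∀ {d} → Acc _<_ d → ∀ i → f (i + suc d) ≡ f i → ClosedWalk f
  shorten {d} (acc rec) i closes with any? (λ a → any? (repeats? {d} i a))
  ... | yes (a , b , a<b , eq) =
    -- Here b = a + suc e, so the inner stretch has length suc e ≤ b ≤ d, while the outer one has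
    -- length suc d.
    let e , a+e≡b = m≤n⇒∃[o]m+o≡n a<b
        e<b = subst (e <_) a+e≡b (s≤s (m≤n+m e (toℕ a)))
        i+b = trans (+-assoc i (toℕ a) (suc e)) (cong (i +_) (trans (+-suc (toℕ a) e) a+e≡b))
    in shorten (rec (<-≤-trans e<b (toℕ≤pred[n] b))) (i + toℕ a)
         (trans (cong f i+b) (sym eq))
  ... | no ¬repeat = record
    { start = i ; last = d ; closes = closes ; simple = simple }
    where
    simple : ∀ (a b : Fin (suc d)) → f (i + toℕ a) ≡ f (i + toℕ b) → a ≡ b
    simple a b eq with <-cmp (toℕ a) (toℕ b)
    ... | tri< a<b _ _ = contradiction (a , b , a<b , eq) ¬repeat
    ... | tri≈ _ a≡b _ = toℕ-injective a≡b
    ... | tri> _ _ b<a = contradiction (b , a , b<a , sym eq) ¬repeat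

-- Redefining a schedule on finitely many nodes

module _ {n k : ℕ} {W : Set} (node : Fin k → Fin n) (p : Fin k → W) (s : Fin n → W) where

  override : Fin n → W
  override x with any? (λ i → node i ≟ x)
  ... | yes (i , _) = p i
  ... | no  _       = s x

  override-in : (∀ i j → node i ≡ node j → i ≡ j) → ∀ i → override (node i) ≡ p i
  override-in inj i with any? (λ j → node j ≟ node i)
  ... | yes (j , eq) = cong p (inj j i eq)
  ... | no  ∄        = contradiction (i , refl) ∄

  override-out : ∀ {x} → (∀ i → node i ≢ x) → override x ≡ s x
  override-out {x} x∉ with any? (λ i → node i ≟ x)
  ... | yes (i , eq) = contradiction eq (x∉ i)
  ... | no  _        = refl

-- Decidable totally ordered abelian groups

-- `WeightStr` carries no laws, so subtraction and the strict order are tied here to the group and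
-- to `_≼_`. Strictness is characterised as failure of the reverse inequality, which fits the
-- differently defined strict orders of ℝ and ℤ alike.
record IsDecOrderedGroup (WS : WeightStr) : Set where
  open WeightStr WS
  field
    neg             : W → W
    isAbelianGroup  : IsAbelianGroup _≡_ _⊕_ 𝟘 neg
    isDecTotalOrder : IsDecTotalOrder _≡_ _≼_
    ⊖≡⊕neg          : ∀ x y → x ⊖ y ≡ x ⊕ neg y
    ⊕-monoˡ-≼       : ∀ z {x y} → x ≼ y → (x ⊕ z) ≼ (y ⊕ z)
    ≺⇒⋡             : ∀ {x y} → x ≺ y → ¬ (y ≼ x)
    ⋡⇒≺             : ∀ {x y} → ¬ (y ≼ x) → x ≺ y

  open IsAbelianGroup isAbelianGroup public
    using (assoc; comm; identityˡ; identityʳ; inverseˡ; inverseʳ)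
  open IsDecTotalOrder isDecTotalOrder public using (isTotalOrder; _≤?_)
    renaming (refl to ≼-refl; trans to ≼-trans; reflexive to ≼-reflexive)

  abelianGroup : AbelianGroup 0ℓ 0ℓ
  abelianGroup = record { isAbelianGroup = isAbelianGroup }

  open AbelianGroupProperties abelianGroup public using (⁻¹-anti-homo-∙; ε⁻¹≈ε)
  open CommutativeSemigroupProperties (AbelianGroup.commutativeSemigroup abelianGroup) public
    using (xy∙z≈xz∙y)

  totalOrder : TotalOrder 0ℓ 0ℓ 0ℓ
  totalOrder = record { isTotalOrder = isTotalOrder }

  open Min totalOrder public using (_⊓_; x⊓y≤x; x⊓y≤y; ⊓-sel)

  ⊖-⊕-cancel : ∀ x y → (x ⊖ y) ⊕ y ≡ x
  ⊖-⊕-cancel x y = trans (cong (_⊕ y) (⊖≡⊕neg x y))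
    (trans (assoc x (neg y) y) (trans (cong (x ⊕_) (inverseˡ y)) (identityʳ x)))

  ⊕-⊖-comm : ∀ x y z → (x ⊕ z) ⊖ y ≡ (x ⊖ y) ⊕ z
  ⊕-⊖-comm x y z = trans (⊖≡⊕neg (x ⊕ z) y)
    (trans (xy∙z≈xz∙y x z (neg y)) (cong (_⊕ z) (sym (⊖≡⊕neg x y))))

  ⊖-monoˡ-≼ : ∀ z {x y} → x ≼ y → (x ⊖ z) ≼ (y ⊖ z)
  ⊖-monoˡ-≼ z {x} {y} x≼y =
    subst₂ _≼_ (sym (⊖≡⊕neg x z)) (sym (⊖≡⊕neg y z)) (⊕-monoˡ-≼ (neg z) x≼y)

  ⊖≼⇒≼⊕ : ∀ {x y z} → (x ⊖ y) ≼ z → x ≼ (z ⊕ y)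
  ⊖≼⇒≼⊕ {x} {y} le = subst (_≼ _) (⊖-⊕-cancel x y) (⊕-monoˡ-≼ y le)

  ≼⊕⇒𝟘≼ : ∀ {x y} → x ≼ (x ⊕ y) → 𝟘 ≼ y
  ≼⊕⇒𝟘≼ {x} {y} le = subst₂ _≼_ (inverseʳ x)
    (trans (xy∙z≈xz∙y x y (neg x)) (trans (cong (_⊕ y) (inverseʳ x)) (identityˡ y)))
    (⊕-monoˡ-≼ (neg x) le)

  𝟘≼⇒neg≼𝟘 : ∀ {x} → 𝟘 ≼ x → neg x ≼ 𝟘
  𝟘≼⇒neg≼𝟘 {x} le = subst₂ _≼_ (identityˡ (neg x)) (inverseʳ x) (⊕-monoˡ-≼ (neg x) le)

-- Telescoping sums and potentials along a sequence

module Theory {WS : WeightStr} (isDecOrderedGroup : IsDecOrderedGroup WS)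
              {n m : ℕ} (𝓗 : HyTNs.HyTN WS n m) where
  open WeightStr WS
  open IsDecOrderedGroup isDecOrderedGroup
  open HyTNs WS
  open HyTN 𝓗
  open Hyperarc

  Σʷ : ∀ {k} → (Fin k → W) → W
  Σʷ = Σᶠ 𝓗

  Σʷ-cong : ∀ {k} {f g : Fin k → W} → f ≗ g → Σʷ f ≡ Σʷ g
  Σʷ-cong {zero}  f≗g = refl
  Σʷ-cong {suc k} f≗g = cong₂ _⊕_ (f≗g zero) (Σʷ-cong (f≗g ∘ suc))

  telescope : ∀ {k} (p : Fin (suc k) → W) (f : Fin k → W) →
              (∀ i → (p (suc i) ⊖ f i) ≼ p (inject₁ i)) → p (fromℕ k) ≼ (p zero ⊕ Σʷ f)
  telescope {zero}  p f _  = ≼-reflexive (sym (identityʳ (p zero)))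
  telescope {suc k} p f le =
    ≼-trans (telescope (p ∘ suc) (f ∘ suc) (le ∘ suc))
      (≼-trans (⊕-monoˡ-≼ (Σʷ (f ∘ suc)) (⊖≼⇒≼⊕ (le zero)))
        (≼-reflexive (assoc (p zero) (f zero) (Σʷ (f ∘ suc)))))

  -- Minus the sum of the remaining weights, so that the value at the end of the sequence is 0.
  pot : ∀ {k} → (Fin k → W) → Fin (suc k) → W
  pot f zero            = neg (Σʷ f)
  pot {suc k} f (suc i) = pot (f ∘ suc) i

  pot-last : ∀ {k} (f : Fin k → W) → pot f (fromℕ k) ≡ 𝟘
  pot-last {zero}  f = ε⁻¹≈ε
  pot-last {suc k} f = pot-last (f ∘ suc)

  -- Dropping the leading weight from the remaining sum raises the potential by exactly that weight,
  -- so each arc along the sequence holds with equality.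
  pot-step : ∀ {k} (f : Fin k → W) i → pot f (suc i) ⊖ f i ≡ pot f (inject₁ i)
  pot-step f zero    = trans (⊖≡⊕neg _ (f zero)) (sym (⁻¹-anti-homo-∙ (f zero) (Σʷ (f ∘ suc))))
  pot-step f (suc i) = pot-step (f ∘ suc) i

  Tight : (Fin n → W) → Fin m → Fin n → Set
  Tight s A v = T (head (arc A) v) × ((s v ⊖ weight (arc A) v) ≼ s (tail (arc A)))

  Satisfies : (Fin n → W) → Fin m → Set
  Satisfies s A = ∃[ v ] Tight s A v

  -- Feasible schedules exclude negative cycles

  consistent⇒conservative : Consistent 𝓗 → Conservative 𝓗
  consistent⇒conservative (s , feasible) (S , 𝓒 , isCycle , negative) =
    ≺⇒⋡ (negative last σ) nonnegative
    where
    open IsCycle isCycle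

    -- `state` and `arcAt` are mutually recursive: membership in `S` yields an arc of `𝓒`, and the
    -- head that `feasible` selects for this arc is the next node, again in `S`.
    state : ℕ → ∃ S

    arcAt : ∀ t → ∃[ A ] (𝓒 A × tail (arc A) ≡ proj₁ (state t))
    arcAt t = a-exists (proj₁ (state t)) (proj₂ (state t))

    state zero    = S-nonempty
    state (suc t) =
      let A , A∈𝓒 , _ = arcAt t
          v , v∈A , _ = feasible A
      in v , proj₂ (⊆S A A∈𝓒) v v∈A

    f : ℕ → Fin n
    f = proj₁ ∘ state

    open ClosedWalk (closedWalk f)

    tight : ∀ t → Tight s (proj₁ (arcAt (start + t))) (f (start + suc t))
    tight t =
      let A = proj₁ (arcAt (start + t))
      in subst (Tight s A ∘ f) (sym (+-suc start t)) (proj₂ (feasible A))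

    f-inject₁ : ∀ {k} (i : Fin k) → f (start + toℕ i) ≡ f (start + toℕ (inject₁ i))
    f-inject₁ i = cong (f ∘ (start +_)) (sym (toℕ-inject₁ i))

    arcTail : ∀ (t : Fin (suc last)) →
              tail (arc (proj₁ (arcAt (start + toℕ t)))) ≡ f (start + toℕ (inject₁ t))
    arcTail t = trans (proj₂ (proj₂ (arcAt (start + toℕ t)))) (f-inject₁ t)

    σ : CyclicSeq 𝓗 S 𝓒 last
    σ = record
      { node      = λ t → f (start + toℕ t)
      ; arcs      = λ t → proj₁ (arcAt (start + toℕ t))
      ; node∈S    = λ t → proj₂ (state (start + toℕ t))
      ; arcs∈𝓒    = λ t → proj₁ (proj₂ (arcAt (start + toℕ t)))
      ; arcs-tail = arcTail
      ; step      = λ t → proj₁ (tight (toℕ t))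
      ; closed    = trans (cong (f ∘ (start +_)) (toℕ-fromℕ (suc last)))
                      (trans closes (cong f (sym (+-identityʳ start))))
      ; distinct  = λ i j eq → simple i j (trans (f-inject₁ i) (trans eq (sym (f-inject₁ j))))
      }

    open CyclicSeq σ

    w : Fin (suc last) → W
    w t = weight (arc (arcs t)) (node (suc t))

    slack : ∀ t → (s (node (suc t)) ⊖ w t) ≼ s (node (inject₁ t))
    slack t = subst (λ v → (s (node (suc t)) ⊖ w t) ≼ s v) (arcs-tail t) (proj₂ (tight (toℕ t)))

    nonnegative : 𝟘 ≼ length-weight
    -- As the sequence is closed, both ends of the telescoped inequality carry the same value of
    -- `s`, which cancels.
    nonnegative = ≼⊕⇒𝟘≼
      (subst (λ v → s v ≼ (s (node zero) ⊕ length-weight)) closed (telescope (s ∘ node) w slack))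

  -- Deciding whether a nonnegative cyclic sequence exists

  module _ {S : Pred (Fin n) 0ℓ} {𝓒 : Pred (Fin m) 0ℓ} (S? : Decidable S) (𝓒? : Decidable 𝓒) where

    NonnegSeq : ℕ → Set
    NonnegSeq k = ∃[ σ ] (𝟘 ≼ CyclicSeq.length-weight {𝓗 = 𝓗} {S} {𝓒} {k} σ)

    Link : Fin n → Fin m → Fin n → Set
    Link u A v = S u × 𝓒 A × tail (arc A) ≡ u × T (head (arc A) v)

    link? : ∀ u A v → Dec (Link u A v)
    link? u A v = S? u ×-dec 𝓒? A ×-dec tail (arc A) ≟ u ×-dec T? (head (arc A) v)

    -- `CyclicSeq` is flattened to a predicate on two functions between finite sets, which can be
    -- decided by search. Membership in `S` is recorded only for sources of arcs; for the last node
    -- it follows from closedness.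
    Nonneg : ∀ {k} → (Fin (suc (suc k)) → Fin n) → (Fin (suc k) → Fin m) → Set
    Nonneg node arcs =
      (∀ t → Link (node (inject₁ t)) (arcs t) (node (suc t))) ×
      (node (fromℕ _) ≡ node zero) ×
      (∀ i j → node (inject₁ i) ≡ node (inject₁ j) → i ≡ j) ×
      (𝟘 ≼ Σʷ (λ t → weight (arc (arcs t)) (node (suc t))))

    nonneg? : ∀ {k} node arcs → Dec (Nonneg {k} node arcs)
    nonneg? node arcs =
      all? (λ t → link? (node (inject₁ t)) (arcs t) (node (suc t))) ×-dec
      node (fromℕ _) ≟ node zero ×-dec
      all? (λ i → all? (λ j → node (inject₁ i) ≟ node (inject₁ j) →-dec i ≟ j)) ×-dec
      𝟘 ≤? Σʷ (λ t → weight (arc (arcs t)) (node (suc t)))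

    nonneg-resp : ∀ {k} {node node′ : Fin (suc (suc k)) → Fin n} {arcs arcs′} →
                  node ≗ node′ → arcs ≗ arcs′ → Nonneg node arcs → Nonneg node′ arcs′
    nonneg-resp {arcs = arcs} {arcs′} n≗ a≗ (links , closed , distinct , 𝟘≼) =
      (λ t → subst (λ u → Link u _ _) (n≗ (inject₁ t))
               (subst₂ (Link _) (a≗ t) (n≗ (suc t)) (links t))) ,
      trans (sym (n≗ (fromℕ _))) (trans closed (n≗ zero)) ,
      (λ i j eq → distinct i j (trans (n≗ (inject₁ i)) (trans eq (sym (n≗ (inject₁ j)))))) ,
      subst (𝟘 ≼_) (Σʷ-cong (λ t → cong₂ (weight ∘ arc) (a≗ t) (n≗ (suc t)))) 𝟘≼

    nonnegSeq? : ∀ k → Dec (NonnegSeq k)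
    nonnegSeq? k = map′ toSeq fromSeq
      (any-fun?
        (λ {node} {node′} n≗ (arcs , p) → arcs , nonneg-resp {node = node} {node′} n≗ (λ _ → refl) p)
        (λ node → any-fun? (nonneg-resp {node = node} (λ _ → refl)) (nonneg? {k} node)))
      where
      toSeq : ∃[ node ] ∃[ arcs ] Nonneg node arcs → NonnegSeq k
      toSeq (node , arcs , links , closed , distinct , 𝟘≼) = record
        { node      = node
        ; arcs      = arcs
        ; node∈S    = node∈S
        ; arcs∈𝓒    = λ t → proj₁ (proj₂ (links t))
        ; arcs-tail = λ t → proj₁ (proj₂ (proj₂ (links t)))
        ; step      = λ t → proj₂ (proj₂ (proj₂ (links t)))
        ; closed    = closed
        ; distinct  = distinct
        } , 𝟘≼
        where
        node∈S : ∀ t → S (node t)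
        node∈S t with view t
        ... | ‵fromℕ         = subst S (sym closed) (proj₁ (links zero))
        ... | ‵inj₁ {i = i} _ = proj₁ (links i)

      fromSeq : NonnegSeq k → ∃[ node ] ∃[ arcs ] Nonneg node arcs
      fromSeq (σ , 𝟘≼) = node , arcs ,
        (λ t → node∈S (inject₁ t) , arcs∈𝓒 t , arcs-tail t , step t) , closed , distinct , 𝟘≼
        where open CyclicSeq σ

    nonnegSeq-bound : ∀ {k} → NonnegSeq k → k < n
    nonnegSeq-bound (σ , _) = injective⇒≤ (λ {i} {j} → CyclicSeq.distinct σ i j)

    -- The nodes before the closing one are distinct, which forces k < n. Only finitely many
    -- candidates remain, so the dichotomy holds constructively.
    nonnegSeq⊎negative :
      ∃ NonnegSeq ⊎ (∀ k (σ : CyclicSeq 𝓗 S 𝓒 k) → CyclicSeq.length-weight σ ≺ 𝟘)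
    nonnegSeq⊎negative with any? {n} (nonnegSeq? ∘ toℕ)
    ... | yes (k , seq) = inj₁ (toℕ k , seq)
    ... | no  ∄         = inj₂ λ k σ → ⋡⇒≺ λ 𝟘≼ →
      let k<n = nonnegSeq-bound (σ , 𝟘≼)
      in ∄ (fromℕ< k<n , subst NonnegSeq (sym (toℕ-fromℕ< k<n)) (σ , 𝟘≼))

  -- Networks with distinct tails

  HasNegativeCycle : Set₁
  HasNegativeCycle = ∃[ S ] ∃[ 𝓒 ] NegativeCycle 𝓗 S 𝓒

  FeasibleOn : Subset m → (Fin n → W) → Set
  FeasibleOn D s = ∀ A → A ∈ D → Satisfies s A

  module DeterministicTails (D : Subset m)
    (tail-injective : ∀ {A B} → A ∈ D → B ∈ D → tail (arc A) ≡ tail (arc B) → A ≡ B) where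

    -- Since the tight head must lie in `R`, the condition depends only on the values of `s` on `R`;
    -- the values elsewhere can still be chosen freely.
    Scheduled : Subset n → (Fin n → W) → Set
    Scheduled R s = ∀ A → A ∈ D → tail (arc A) ∈ R → ∃[ v ] (v ∈ R × Tight s A v)

    Growth : Subset n → Set
    Growth R = ∃[ R′ ] (R ⊂ R′ × ∃ (Scheduled R′))

    module _ {R : Subset n} {s : Fin n → W} (scheduled : Scheduled R s)
             {k : ℕ} (node : Fin (suc k) → Fin n) (p : Fin (suc k) → W) where

      Supported : Fin (suc k) → Fin m → Set
      Supported i A = ∃[ v ] (T (head (arc A) v) ×
        ((v ∈ R × ((s v ⊖ weight (arc A) v) ≼ p i)) ⊎
         ∃[ j ] (node j ≡ v × ((p j ⊖ weight (arc A) v) ≼ p i))))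

      -- The new nodes avoid `R`, so old values and the inequalities between them survive;
      -- injectivity of `node` makes the new values unambiguous.
      grow : (∀ i j → node i ≡ node j → i ≡ j) → (∀ i → node i ∉ R) →
             (∀ i A → A ∈ D → tail (arc A) ≡ node i → Supported i A) → Growth R
      grow injective fresh supported with comprehension (λ x → (x ∈? R) ⊎-dec any? (λ i → node i ≟ x))
      ... | R′ , intro , elim =
        R′ , (intro ∘ inj₁ , node zero , intro (inj₂ (zero , refl)) , fresh zero) , s′ , scheduled′
        where
        s′ : Fin n → W
        s′ = override node p s

        s′-old : ∀ {x} → x ∈ R → s′ x ≡ s x
        s′-old x∈R = override-out node p s (λ i eq → fresh i (subst (_∈ R) (sym eq) x∈R))

        s′-new : ∀ {x} i → node i ≡ x → s′ x ≡ p i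
        s′-new i refl = override-in node p s injective i

        scheduled′ : Scheduled R′ s′
        scheduled′ A A∈D tail∈R′ with elim tail∈R′
        ... | inj₁ tail∈R with scheduled A A∈D tail∈R
        ...   | v , v∈R , v∈A , le = v , intro (inj₁ v∈R) , v∈A ,
                subst₂ (λ x y → (x ⊖ weight (arc A) v) ≼ y) (sym (s′-old v∈R)) (sym (s′-old tail∈R)) le
        scheduled′ A A∈D tail∈R′ | inj₂ (i , eq) with supported i A A∈D (sym eq)
        ...   | v , v∈A , inj₁ (v∈R , le) = v , intro (inj₁ v∈R) , v∈A ,
                subst₂ (λ x y → (x ⊖ weight (arc A) v) ≼ y) (sym (s′-old v∈R)) (sym (s′-new i eq)) le
        ...   | v , v∈A , inj₂ (j , eq′ , le) = v , intro (inj₂ (j , eq′)) , v∈A ,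
                subst₂ (λ x y → (x ⊖ weight (arc A) v) ≼ y) (sym (s′-new j eq′)) (sym (s′-new i eq)) le

    growBy : ∀ {R s} → Scheduled R s → ∀ {u} → u ∉ R → ∀ c →
             (∀ A → A ∈ D → tail (arc A) ≡ u →
              ∃[ v ] (T (head (arc A) v) × v ∈ R × ((s v ⊖ weight (arc A) v) ≼ c))) → Growth R
    growBy scheduled {u} u∉R c supported =
      grow scheduled {k = 0} (λ _ → u) (λ _ → c) (λ { zero zero _ → refl }) (λ _ → u∉R)
        (λ _ A A∈D eq → let v , v∈A , v∈R , le = supported A A∈D eq in v , v∈A , inj₁ (v∈R , le))

    Outside : Subset n → Pred (Fin m) 0ℓ
    Outside R A = A ∈ D × tail (arc A) ∉ R

    outside? : ∀ R → Decidable (Outside R)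
    outside? R A = A ∈? D ×-dec ¬? (tail (arc A) ∈? R)

    Reaches : Subset n → Fin m → Fin n → Set
    Reaches R A v = Outside R A × T (head (arc A) v) × v ∈ R

    reaches? : ∀ R A v → Dec (Reaches R A v)
    reaches? R A v = outside? R A ×-dec T? (head (arc A) v) ×-dec v ∈? R

    HasArc : Fin n → Set
    HasArc v = ∃[ A ] (A ∈ D × tail (arc A) ≡ v)

    hasArc? : Decidable HasArc
    hasArc? v = any? (λ A → A ∈? D ×-dec tail (arc A) ≟ v)

    -- The new nodes receive the potentials `pot w`. By distinctness of tails, the only arc of `D`
    -- to be satisfied at each of them is the one used by the sequence, and `pot-step` satisfies it,
    -- except that the closing step returns to the first node.
    growByCycle : ∀ {R s} → Scheduled R s → ∀ {k} (σ : CyclicSeq 𝓗 (_∉ R) (Outside R) k) →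
                  𝟘 ≼ CyclicSeq.length-weight σ → Growth R
    growByCycle {R} scheduled σ 𝟘≼ =
      grow scheduled (node ∘ inject₁) (pot w ∘ inject₁) distinct (node∈S ∘ inject₁) supported
      where
      open CyclicSeq σ

      w : Fin _ → W
      w t = weight (arc (arcs t)) (node (suc t))

      wrap : ∀ j → ∃[ i ] (node (inject₁ i) ≡ node j × (pot w (inject₁ i) ≼ pot w j))
      wrap j with view j
      -- The last node has potential 0 but is assigned the value of the first node, minus the total
      -- weight. This is at most 0 because the total is nonnegative, and a smaller head value is
      -- harmless.
      ... | ‵fromℕ          = zero , sym closed , subst (pot w zero ≼_) (sym (pot-last w)) (𝟘≼⇒neg≼𝟘 𝟘≼)
      ... | ‵inj₁ {i = i} _ = i , refl , ≼-refl

      supported : ∀ i A → A ∈ D → tail (arc A) ≡ node (inject₁ i) → _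
      supported i A A∈D eq with tail-injective A∈D (proj₁ (arcs∈𝓒 i)) (trans eq (sym (arcs-tail i)))
      ... | refl =
        let j , eq′ , le = wrap (suc i)
        in node (suc i) , step i , inj₂ (j , eq′ ,
             subst ((pot w (inject₁ j) ⊖ w i) ≼_) (pot-step w i) (⊖-monoˡ-≼ (w i) le))

    -- When nothing grows, each node outside `R` has an arc of `D`, and no head of such an arc lies
    -- in `R`. The complement with these arcs is therefore closed, and if nonempty it is a cycle
    -- whose cyclic sequences are all negative.
    grow⊎complement : ∀ {R s} → Scheduled R s →
                      Growth R ⊎ (∀ v → v ∈ R) ⊎ HasNegativeCycle
    grow⊎complement {R} {s} scheduled with any? (λ v → ¬? (v ∈? R) ×-dec ¬? (hasArc? v))
    ... | yes (v , v∉R , ∄arc) =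
      -- Any value would do: no arc of `D` constrains `v`.
      inj₁ (growBy scheduled v∉R (s v) (λ A A∈D eq → contradiction (A , A∈D , eq) ∄arc))
    ... | no ∄sink with any? (λ A → any? (reaches? R A))
    ...   | yes (A , v , (A∈D , tail∉R) , v∈A , v∈R) =
      -- This is the least value at the tail for which the head `v` satisfies `A`, and `A` is the
      -- only arc of `D` there.
      inj₁ (growBy scheduled tail∉R (s v ⊖ weight (arc A) v) supported)
      where
      supported : ∀ B → B ∈ D → tail (arc B) ≡ tail (arc A) → _
      supported B B∈D eq with tail-injective B∈D A∈D eq
      ... | refl = v , v∈A , v∈R , ≼-refl
    ...   | no ∄reach with nonnegSeq⊎negative (λ v → ¬? (v ∈? R)) (outside? R)
    ...     | inj₁ (k , σ , 𝟘≼) = inj₁ (growByCycle scheduled σ 𝟘≼)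
    ...     | inj₂ negative with any? (λ v → ¬? (v ∈? R))
    ...       | no ∄ = inj₂ (inj₁ λ v → decidable-stable (v ∈? R) (λ v∉R → ∄ (v , v∉R)))
    ...       | yes nonempty = inj₂ (inj₂ ((_∉ R) , Outside R , isCycle , negative))
      where
      arcOf : ∀ v → v ∉ R → ∃[ A ] (Outside R A × tail (arc A) ≡ v)
      arcOf v v∉R with hasArc? v
      ... | yes (A , A∈D , refl) = A , (A∈D , v∉R) , refl
      ... | no ∄arc              = contradiction (v , v∉R , ∄arc) ∄sink

      isCycle : IsCycle 𝓗 (_∉ R) (Outside R)
      isCycle = record
        { S⊆         = λ v v∉R → let A , A∈ , eq = arcOf v v∉R in A , A∈ , inj₂ eq
        ; ⊆S         = λ A A∈ → proj₂ A∈ , λ v v∈A v∈R → ∄reach (A , v , A∈ , v∈A , v∈R)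
        ; S-nonempty = nonempty
        ; a-exists   = arcOf
        ; a-unique   = λ A B A∈ B∈ → tail-injective (proj₁ A∈) (proj₁ B∈)
        }

    saturate : ∀ {R s} → Acc _⊃_ R → Scheduled R s → ∃ (FeasibleOn D) ⊎ HasNegativeCycle
    saturate {s = s} (acc rec) scheduled with grow⊎complement scheduled
    ... | inj₁ (R′ , R⊂R′ , s′ , scheduled′) = saturate (rec R⊂R′) scheduled′
    ... | inj₂ (inj₁ full)  = inj₁ (s , λ A A∈D →
      let v , _ , tight = scheduled A A∈D (full (tail (arc A))) in v , tight)
    ... | inj₂ (inj₂ cycle) = inj₂ cycle

    feasible⊎negativeCycle : ∃ (FeasibleOn D) ⊎ HasNegativeCycle
    feasible⊎negativeCycle =
      saturate {∅} {λ _ → 𝟘} (⊃-wellFounded ∅) (λ _ _ tail∈∅ → contradiction tail∈∅ ∉⊥)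

  -- Recombining schedules at a shared tail

  -- Lowering head values only relaxes the constraint, as long as the value at the tail is kept.
  satisfies-lower : ∀ {s s′ A} → (∀ v → s′ v ≼ s v) → s′ (tail (arc A)) ≡ s (tail (arc A)) →
                    Satisfies s A → Satisfies s′ A
  satisfies-lower {A = A} s′≼s eq (v , v∈A , le) =
    v , v∈A , ≼-trans (⊖-monoˡ-≼ (weight (arc A) v) (s′≼s v)) (subst (_ ≼_) (sym eq) le)

  satisfies-shift : ∀ {s A} c → Satisfies s A → Satisfies (λ v → s v ⊕ c) A
  satisfies-shift {s} {A} c (v , v∈A , le) =
    v , v∈A , subst (_≼ _) (sym (⊕-⊖-comm (s v) (weight (arc A) v) c)) (⊕-monoˡ-≼ c le)

  -- At each tail the minimum equals one of the two schedules, and an arc satisfied by that schedule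
  -- stays satisfied by `satisfies-lower`. Only `A` and `B` are each missing from one network; at
  -- their common tail both schedules agree, so `s₂` can serve `A` and `s₁′` can serve `B`.
  merge : ∀ {D A B} → A ≢ B → tail (arc A) ≡ tail (arc B) →
          ∃ (FeasibleOn (D - A)) → ∃ (FeasibleOn (D - B)) → ∃ (FeasibleOn D)
  merge {D} {A} {B} A≢B tails (s₁ , feasible₁) (s₂ , feasible₂) = s , feasible
    where
    c : W
    c = s₂ (tail (arc A)) ⊖ s₁ (tail (arc A))

    s₁′ s : Fin n → W
    s₁′ v = s₁ v ⊕ c
    s v   = s₁′ v ⊓ s₂ v

    lower₁ : ∀ {C} → s (tail (arc C)) ≡ s₁′ (tail (arc C)) → C ∈ D → C ≢ A → Satisfies s C
    lower₁ eq C∈D C≢A = satisfies-lower (λ v → x⊓y≤x (s₁′ v) (s₂ v)) eq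
      (satisfies-shift c (feasible₁ _ (x∈p∧x≢y⇒x∈p-y C∈D C≢A)))

    lower₂ : ∀ {C} → s (tail (arc C)) ≡ s₂ (tail (arc C)) → C ∈ D → C ≢ B → Satisfies s C
    lower₂ eq C∈D C≢B = satisfies-lower (λ v → x⊓y≤y (s₁′ v) (s₂ v)) eq
      (feasible₂ _ (x∈p∧x≢y⇒x∈p-y C∈D C≢B))

    agree : s₁′ (tail (arc A)) ≡ s₂ (tail (arc A))
    agree = trans (comm _ c) (⊖-⊕-cancel _ _)

    at-tail : s (tail (arc A)) ≡ s₂ (tail (arc A))
    at-tail = [ (λ eq → trans eq agree) , (λ eq → eq) ]′ (⊓-sel _ _)

    feasible : FeasibleOn D s
    feasible C C∈D with C ≟ A | C ≟ B
    ... | yes refl | _        = lower₂ at-tail C∈D A≢B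
    ... | no  C≢A  | yes refl =
      lower₁ (subst (λ v → s v ≡ s₁′ v) tails (trans at-tail (sym agree))) C∈D C≢A
    ... | no  C≢A  | no  C≢B  =
      [ (λ eq → lower₁ eq C∈D C≢A) , (λ eq → lower₂ eq C∈D C≢B) ]′ (⊓-sel _ _)

  Conflict : Subset m → Fin m → Fin m → Set
  Conflict D A B = A ∈ D × B ∈ D × A ≢ B × tail (arc A) ≡ tail (arc B)

  conflict? : ∀ D A B → Dec (Conflict D A B)
  conflict? D A B = A ∈? D ×-dec B ∈? D ×-dec ¬? (A ≟ B) ×-dec tail (arc A) ≟ tail (arc B)

  -- `HasNegativeCycle` does not mention `D`, so a negative cycle found after removing an arc is
  -- passed on unchanged.
  feasible⊎negativeCycle : ∀ {D} → Acc _⊂_ D → ∃ (FeasibleOn D) ⊎ HasNegativeCycle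
  feasible⊎negativeCycle {D} (acc rec) with any? (λ A → any? (conflict? D A))
  ... | no ∄conflict = DeterministicTails.feasible⊎negativeCycle D
    (λ {A} {B} A∈D B∈D eq → decidable-stable (A ≟ B) (λ A≢B → ∄conflict (A , B , A∈D , B∈D , A≢B , eq)))
  ... | yes (A , B , A∈D , B∈D , A≢B , eq)
    with feasible⊎negativeCycle (rec (x∈p⇒p-x⊂p A∈D)) | feasible⊎negativeCycle (rec (x∈p⇒p-x⊂p B∈D))
  ...   | inj₂ cycle | _          = inj₂ cycle
  ...   | inj₁ _     | inj₂ cycle = inj₂ cycle
  ...   | inj₁ s₁    | inj₁ s₂    = inj₁ (merge A≢B eq s₁ s₂)

  conservative⇒consistent : Conservative 𝓗 → Consistent 𝓗
  conservative⇒consistent conservative with feasible⊎negativeCycle (⊂-wellFounded ⊤)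
  ... | inj₁ (s , feasible) = s , λ A → feasible A ∈⊤
  ... | inj₂ cycle          = contradiction cycle conservative

  consistent⇔conservative : Consistent 𝓗 ⇔ Conservative 𝓗
  consistent⇔conservative = mk⇔ consistent⇒conservative conservative⇒consistent

-- Decidability of total orders, and the instances ℝ and ℤ

-- Totality is a function into a disjoint sum, so x ≡ y forces total x y and total y x to pick the
-- same summand, whereas picking the same summand yields both inequalities.
totalOrder-≟ : {A : Set} {_≼_ : A → A → Set} → IsTotalOrder _≡_ _≼_ → ∀ x y → Dec (x ≡ y)
totalOrder-≟ isTotalOrder x y = decide (total x y) (total y x) refl refl
  where
  open IsTotalOrder isTotalOrder using (total; antisym; reflexive)
  inj₁≢inj₂ : ∀ {A B : Set} {z : A ⊎ B} {a b} → z ≡ inj₁ a → z ≢ inj₂ b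
  inj₁≢inj₂ refl ()

  decide : ∀ p q → total x y ≡ p → total y x ≡ q → Dec (x ≡ y)
  decide (inj₁ x≼y) (inj₁ y≼x) _  _  = yes (antisym x≼y y≼x)
  decide (inj₂ y≼x) (inj₂ x≼y) _  _  = yes (antisym x≼y y≼x)
  decide (inj₁ _)   (inj₂ _)   eq eq′ = no λ { refl → inj₁≢inj₂ eq eq′ }
  decide (inj₂ _)   (inj₁ _)   eq eq′ = no λ { refl → inj₁≢inj₂ eq′ eq }

isDecTotalOrder : {A : Set} {_≼_ : A → A → Set} → IsTotalOrder _≡_ _≼_ → IsDecTotalOrder _≡_ _≼_
isDecTotalOrder {_≼_ = _≼_} isTotalOrder = record
  { isTotalOrder = isTotalOrder ; _≟_ = totalOrder-≟ isTotalOrder ; _≤?_ = _≼?_ }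
  where
  open IsTotalOrder isTotalOrder using (total; antisym; reflexive)
  _≼?_ : ∀ x y → Dec (x ≼ y)
  x ≼? y with total x y
  ... | inj₁ x≼y = yes x≼y
  -- Given y ≼ x, antisymmetry reduces x ≼ y to equality.
  ... | inj₂ y≼x = map′ reflexive (λ x≼y → antisym x≼y y≼x) (totalOrder-≟ isTotalOrder x y)

ℝ-isDecOrderedGroup : (ℝs : RealNumbers) → IsDecOrderedGroup (RealNumbers.weightStr ℝs)
ℝ-isDecOrderedGroup ℝs = record
  { neg             = -_
  ; isAbelianGroup  = IsCommutativeRing.+-isAbelianGroup isCommutativeRing
  ; isDecTotalOrder = isDecTotalOrder isTotalOrder
  ; ⊖≡⊕neg          = λ _ _ → refl
  ; ⊕-monoˡ-≼       = λ z → +-mono-≤ z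
  ; ≺⇒⋡             = λ (x≤y , x≢y) y≤x → x≢y (antisym x≤y y≤x)
  ; ⋡⇒≺             = λ {x} {y} y≰x →
      [ (λ x≤y → x≤y , λ { refl → y≰x x≤y }) , (λ y≤x → contradiction y≤x y≰x) ]′ (total x y)
  }
  where
  open RealNumbers ℝs using (-_; isCommutativeRing; isTotalOrder; +-mono-≤)
  open IsTotalOrder isTotalOrder using (total; antisym; reflexive)

ℤ-isDecOrderedGroup : IsDecOrderedGroup ℤ-weightStr
ℤ-isDecOrderedGroup = record
  { neg             = ℤ.-_
  ; isAbelianGroup  = ℤ.+-0-isAbelianGroup
  ; isDecTotalOrder = ℤ.≤-isDecTotalOrder
  ; ⊖≡⊕neg          = λ _ _ → refl
  ; ⊕-monoˡ-≼       = λ z → ℤ.+-monoˡ-≤ z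
  ; ≺⇒⋡             = ℤ.<⇒≱
  ; ⋡⇒≺             = ℤ.≰⇒>
  }

theorem4 : ((ℝs : RealNumbers) → (n m : ℕ) → (𝓗 : HyTNs.HyTN (RealNumbers.weightStr ℝs) n m) →
    HyTNs.Consistent (RealNumbers.weightStr ℝs) 𝓗 ⇔ HyTNs.Conservative (RealNumbers.weightStr ℝs) 𝓗)
    × ((n m : ℕ) → (𝓗 : HyTNs.HyTN ℤ-weightStr n m) →
    HyTNs.Consistent ℤ-weightStr 𝓗 ⇔ HyTNs.Conservative ℤ-weightStr 𝓗)
theorem4 =
  (λ ℝs n m 𝓗 → Theory.consistent⇔conservative (ℝ-isDecOrderedGroup ℝs) 𝓗) ,
  (λ n m 𝓗 → Theory.consistent⇔conservative ℤ-isDecOrderedGroup 𝓗)
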